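{- If the sequences $(a)^j$ and $(b)^j$ are realisable by a hypergraph with $m$ edges and $n$ vertices, then the sequences $(a)^{j+1}$ and $(b)^{j+1}$, as constructed by the random generation algorithm at iteration $j$, are realisable by a hypergraph with $m-1$ edges and $n$ vertices.
   Context: A hypergraph $H=(V,E)$ consists of a vertex set $V=\{v_1,\dots,v_n\}$ and a multiset $E$ of edges, each edge being a subset of $V$. Hypergraphs are labelled, may contain parallel (repeated) edges, and have no self-loops (a vertex occurs at most once in an edge). The degree of a vertex is the number of edges (counted with multiplicity) containing it; the dimension of an edge is its cardinality. A pair of sequences $(a),(b)$ is realisable by a hypergraph with $m$ edges and $n$ vertices if there is such a hypergraph with degree sequence $(a)$ (of length $n$) and dimension sequence $(b)$ (of length $m$). The hypergraph with $n$ vertices and $E=\emptyset$ is the only hypergraph with $0$ edges and $n$ vertices. The conjugate sequence $(\bar b)$ of $(b)$ is the sequence whose $i$-th component is the number of components of $(b)$ that are $\ge i$; for row-sums of a $(0,1)$-matrix with $n$ columns its length is at most $n$. For sequences $(x),(y)$, zero-padded to a common length $l$, $(x)\prec(y)$ means $\sum_{i=1}^k x_i\le\sum_{i=1}^k y_i$ for $k=1,\dots,l-1$, and $\sum_{i=1}^l x_i=\sum_{i=1}^l y_i$. Random generation algorithm. Input: a degree sequence and a dimension sequence, both sorted in descending order; these are $(a)^1$ and $(b)^1$. Start with $E=\emptyset$. Iteration $j$ starts from $(a)^j=(a^j_1,\dots,a^j_n)$ and $(b)^j=(b^j_1,\dots,b^j_m)$, both sorted in descending order (in this statement $m$ is the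 number of edges still to be generated at the start of iteration $j$), and does the following. 1. Construct $(\bar b)^{j+1}$ from the conjugate sequence $(\bar b)^j$ of $(b)^j$ by reducing the first $b^j_1$ components by $1$. This is the conjugate sequence of $(b)^{j+1}=(b^j_2,\dots,b^j_m)$. 2. Compute all critical indices $k^j_1<k^j_2<\cdots$ at which the dominance $(a)^j\prec(\bar b)^{j+1}$ is violated, where an index $1\le k<n$ is critical if $\sum_{i=1}^k a^j_i>\sum_{i=1}^k\bar b^{j+1}_i$. Compute the corresponding margins of violation $n^j_1,n^j_2,\dots$, where the margin of a critical index $k$ is $\sum_{i=1}^k a^j_i-\sum_{i=1}^k\bar b^{j+1}_i$. Put $k^j_0=0$. The critical indices are taken to partition $\{1,\dots,n\}$ into the integer intervals $\mathcal I^j_i=[k^j_{i-1}+1,k^j_i]$. 3. Start with $e_j=\emptyset$. For each critical index $k^j_i$ in turn: sample an integer $o_i$ uniformly at random from $[\,n^j_i-|e_j|,\ \min(b^j_1-|e_j|,\,k^j_i-k^j_{i-1})\,]$, where $e_j$ is the current partial edge; select a set $O_i$ of $o_i$ indices from $\mathcal I^j_i$ uniformly at random; add the vertices at those indices to $e_j$; and reduce the components of $(a)^j$ at the positions in $O_i$ by $1$. The vertices are selected such that, after all critical indices have been considered, the total number of vertices selected for $e_j$ is $b^j_1$. 4. Add $e_j$ to $E$. Let $(a)^{j+1}$ be the reduced sequence sorted in descending order, and let $(b)^{j+1}=(b^j_2,\dots,b^j_m)$. -}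

module Defs where

open import Data.Bool.Base using (if_then_else_)
open import Data.Fin.Base using (Fin; toℕ)
open import Data.Fin.Subset using (Subset; _∈_; _∪_; ∣_∣) renaming (⊥ to ∅)
open import Data.Fin.Subset.Properties using (_∈?_)
open import Data.List.Base as List using (List; []; _∷_; _++_; [_])
open import Data.List.Relation.Binary.Permutation.Propositional using (_↭_)
open import Data.Nat.Base using (ℕ; suc; _∸_; _⊓_; _≤_; _<_; _≥_)
open import Data.Nat.Properties using (_≤?_; _<?_)
open import Data.Product.Base using (∃-syntax; _×_)
open import Data.Vec.Base as Vec using (Vec; lookup; tabulate; count; head; tail; toList)
open import Data.Vec.Relation.Unary.Linked using (Linked)
open import Relation.Binary.PropositionalEquality.Core using (_≡_)
open import Relation.Nullary.Decidable.Core using (does)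

private
  variable
    m n : ℕ

-- The edges form a multiset; here they are listed in some order, so that
-- parallel edges are repeated entries.
Hypergraph : (m n : ℕ) → Set
Hypergraph m n = Vec (Subset n) m

degree : Hypergraph m n → Fin n → ℕ
degree E v = count (v ∈?_) E

degreeSequence : Hypergraph m n → Vec ℕ n
degreeSequence E = tabulate (degree E)

dimensionSequence : Hypergraph m n → Vec ℕ m
dimensionSequence E = Vec.map ∣_∣ E

Realisable : Vec ℕ n → Vec ℕ m → Set
Realisable {n} {m} a b =
  ∃[ E ] degreeSequence {m} {n} E ≡ a × dimensionSequence E ≡ b

Descending : Vec ℕ n → Set
Descending = Linked _≥_

-- A position i : Fin n stands for the index suc (toℕ i) of {1, …, n}.
index : Fin n → ℕ
index i = suc (toℕ i)

-- The conjugate sequence, zero-padded to length n.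
conjugate : (n : ℕ) → Vec ℕ m → Vec ℕ n
conjugate n b = tabulate λ i → count (index i ≤?_) b

reduceFirst : ℕ → Vec ℕ n → Vec ℕ n
reduceFirst k x = tabulate λ i →
  if does (index i ≤? k) then lookup x i ∸ 1 else lookup x i

reduceAt : Subset n → Vec ℕ n → Vec ℕ n
reduceAt O x = tabulate λ i →
  if does (i ∈? O) then lookup x i ∸ 1 else lookup x i

prefixSum : ℕ → Vec ℕ n → ℕ
prefixSum k x = List.sum (List.take k (toList x))

-- The indices 1 ≤ k < n at which the dominance x ≺ y is violated, in
-- increasing order.
criticalIndices : (x y : Vec ℕ n) → List ℕ
criticalIndices {n} x y =
  List.filter (λ k → prefixSum k y <? prefixSum k x) (List.applyUpTo suc (n ∸ 1))

-- Truncated subtraction is exact at a critical index.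
margin : (x y : Vec ℕ n) → ℕ → ℕ
margin x y k = prefixSum k x ∸ prefixSum k y

-- The right end points of the intervals partitioning {1, …, n}.  The last
-- interval ends at n, where the margin is the size of the edge being built.
endpoints : (x y : Vec ℕ n) → List ℕ
endpoints {n} x y = criticalIndices x y ++ [ n ]

-- O is contained in the integer interval [k₀ + 1 , k].
_⊆⟨_,_] : Subset n → ℕ → ℕ → Set
O ⊆⟨ k₀ , k ] = ∀ {i} → i ∈ O → k₀ < index i × index i ≤ k

-- Selecting μ d k₀ ks e x e′ x′ : with margins μ and target size d, starting
-- from the partial edge e, the partly reduced sequence x and the previous end
-- point k₀, processing the end points ks can lead to e′ and x′.  Every outcome
-- of the random choices is allowed.  A number of indices is never negative, so
-- a negative lower end of the sampling range is replaced by 0.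
data Selecting (μ : ℕ → ℕ) (d : ℕ) {n : ℕ} :
       ℕ → List ℕ → Subset n → Vec ℕ n → Subset n → Vec ℕ n → Set where
  done   : ∀ {k₀ e x} → Selecting μ d k₀ [] e x e x
  select : ∀ {k₀ k ks e x e′ x′} (O : Subset n) →
           O ⊆⟨ k₀ , k ] →
           μ k ∸ ∣ e ∣ ≤ ∣ O ∣ →
           ∣ O ∣ ≤ (d ∸ ∣ e ∣) ⊓ (k ∸ k₀) →
           Selecting μ d k ks (e ∪ O) (reduceAt O x) e′ x′ →
           Selecting μ d k₀ (k ∷ ks) e x e′ x′

-- One iteration of the random generation algorithm can turn (a , b) into
-- (a′ , b′).
record Iteration (a : Vec ℕ n) (b : Vec ℕ (suc m)) (a′ : Vec ℕ n) (b′ : Vec ℕ m) : Set where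
  b̄′ : Vec ℕ n
  b̄′ = reduceFirst (head b) (conjugate n b)

  field
    edge       : Subset n
    reduced    : Vec ℕ n
    selecting  : Selecting (margin a b̄′) (head b) 0 (endpoints a b̄′) ∅ a edge reduced
    size       : ∣ edge ∣ ≡ head b
    descending : Descending a′
    sorted     : toList a′ ↭ toList reduced
    rest       : b′ ≡ tail b

{-# OPTIONS --safe #-}

-- Write ȳ for the conjugate of the remaining dimension sequence, and call
-- Σᵢ (xᵢ ∸ v) the excess of x over v.  If t entries of a are above v, reducing a
-- along the edge e leaves the excess A(t) − |e ∩ {1, …, t}| − t v, where A(t) is
-- the t-th prefix sum of a; the margins bound this by the t-th prefix sum of ȳ
-- minus t v, hence by the excess of ȳ.  The excess does not depend on the order
-- of the entries, and for descending ȳ it controls the prefix sums, so a′ ≺ ȳ.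
-- Finally ȳ is realised by edges that are initial segments of the vertices, and
-- unit transfers from a vertex of larger to one of smaller degree turn this
-- hypergraph into a realisation of a′.
module Submission where

open import Defs
import Algebra.Properties.CommutativeSemigroup as CommutativeSemigroup
open import Data.Bool.Base using (true; false; if_then_else_)
open import Data.Fin.Base using (Fin; zero; suc; toℕ)
open import Data.Fin.Subset using (Subset; inside; outside; _∈_; _∉_; _⊆_; _∪_; _∩_; ∣_∣; ⊥)
open import Data.Fin.Subset.Properties
open import Data.List.Base as List using (List; []; _∷_)
import Data.List.Membership.Propositional as ListMembership
open import Data.List.Membership.Propositional.Properties using (∈-filter⁺; ∈-applyUpTo⁺; ∈-++⁺ˡ; ∈-++⁺ʳ)
import Data.List.Properties as List
open import Data.List.Relation.Binary.Permutation.Propositional using (_↭_)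
import Data.List.Relation.Binary.Permutation.Propositional.Properties as Perm
open import Data.List.Relation.Unary.All as ListAll using ([]; _∷_)
import Data.List.Relation.Unary.All.Properties as ListAll
open import Data.List.Relation.Unary.AllPairs using (AllPairs; []; _∷_)
import Data.List.Relation.Unary.AllPairs.Properties as AllPairs
import Data.List.Relation.Unary.Any as Any
open import Data.Nat.Base
open import Data.Nat.ListAction using (sum)
open import Data.Nat.ListAction.Properties using (sum-↭)
open import Data.Nat.Properties
open import Data.Nat.Solver using (module +-*-Solver)
open import Data.Product.Base using (∃-syntax; _×_; _,_; proj₁; proj₂)
open import Data.Sum.Base using (inj₁; inj₂)
open import Data.Vec.Base as Vec using (Vec; []; _∷_; lookup; tabulate; toList; updateAt; zipWith; count; _[_]≔_; here; there)
open import Data.Vec.Properties using (lookup∘tabulate; lookup∘update′; lookup-zipWith; tabulate-cong)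
open import Data.Vec.Relation.Unary.All as All using (All; []; _∷_)
open import Data.Vec.Relation.Unary.Linked as Linked using ([]; [-]; _∷_)
import Data.Vec.Relation.Unary.Linked.Properties as Linked
open import Function.Base using (_∘_; id; flip)
open import Relation.Binary.PropositionalEquality
open import Relation.Nullary using (yes; no; does; contradiction)

open CommutativeSemigroup +-commutativeSemigroup using (x∙yz≈y∙xz; interchange)

private
  variable
    m n : ℕ

total : Vec ℕ n → ℕ
total x = sum (toList x)

-- Unit transfers between the entries of a sequence

-- The strict inequality makes entry `i` positive, so that `pred` really removes a unit, and it
-- rules out `i ≡ j`. If the two entries differ by one, the transfer swaps their values.
Transferable : (Vec ℕ n → Set) → Set
Transferable R = ∀ y i j → lookup y j < lookup y i → R y →
                 R (updateAt (updateAt y i pred) j suc)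

-- c is a surplus carried over from earlier entries of y.
Dominated : ℕ → Vec ℕ n → Vec ℕ n → Set
Dominated c x y = (∀ k → prefixSum k x ≤ c + prefixSum k y) × total x ≡ c + total y

Dominated-∷⁺ : ∀ {c d x} {xs ys : Vec ℕ n} →
               Dominated (c + d) xs ys → Dominated c (x ∷ xs) (x + d ∷ ys)
Dominated-∷⁺ {c = c} {d} {x} {xs} {ys} (p , t) = p′ , trans (cong (x +_) t) (shuffle (total ys))
  where
  shuffle : ∀ s → x + (c + d + s) ≡ c + (x + d + s)
  shuffle s = solve 4 (λ x c d s → x :+ (c :+ d :+ s) := c :+ (x :+ d :+ s)) refl x c d s
    where open +-*-Solver

  p′ : ∀ k → prefixSum k (x ∷ xs) ≤ c + prefixSum k (x + d ∷ ys)
  p′ zero    = z≤n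
  p′ (suc k) = ≤-trans (+-monoʳ-≤ x (p k)) (≤-reflexive (shuffle (prefixSum k ys)))

Dominated-∷⁻ : ∀ {c d x} {xs ys : Vec ℕ n} →
               Dominated c (x ∷ xs) (x + d ∷ ys) → Dominated (c + d) xs ys
Dominated-∷⁻ {c = c} {d} {x} {xs} {ys} (p , t) =
  (λ k → +-cancelˡ-≤ x _ _ (≤-trans (p (suc k)) (≤-reflexive (shuffle (prefixSum k ys))))) ,
  +-cancelˡ-≡ x _ _ (trans t (shuffle (total ys)))
  where
  shuffle : ∀ s → c + (x + d + s) ≡ x + (c + d + s)
  shuffle s = solve 4 (λ x c d s → c :+ (x :+ d :+ s) := x :+ (c :+ d :+ s)) refl x c d s
    where open +-*-Solver

-- The first entry of `y` below its partner in `x` absorbs one unit of the surplus. Each earlier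
-- entry of `y` passes its lead `d` on to the surplus, and equality of the totals prevents running
-- off the end.
Dominated-raise : ∀ c (x y : Vec ℕ n) → Dominated (suc c) x y →
                  ∃[ j ] lookup y j < lookup x j × Dominated c x (updateAt y j suc)
Dominated-raise c [] [] (_ , ())
Dominated-raise c (x ∷ xs) (y ∷ ys) D@(p , t) with y <? x
... | yes y<x = zero , y<x , p′ , trans t (sym (+-suc c _))
  where
  p′ : ∀ k → prefixSum k (x ∷ xs) ≤ c + prefixSum k (suc y ∷ ys)
  p′ zero    = z≤n
  p′ (suc k) = ≤-trans (p (suc k)) (≤-reflexive (sym (+-suc c _)))
... | no y≮x with d , refl ← m≤n⇒∃[o]m+o≡n (≮⇒≥ y≮x)
             with j , lt , D′ ← Dominated-raise (c + d) xs ys (Dominated-∷⁻ D) =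
  suc j , lt , Dominated-∷⁺ D′

-- The first prefix sum shows that the head of `y` leads that of `x` by some `d`. This lead moves
-- unit by unit to later entries; once the heads agree, the tails are treated with the head absorbed
-- into `R`.
dominated-transfer : (R : Vec ℕ n → Set) → Transferable R → ∀ {x y} → Descending x →
                     Dominated 0 x y → R y → R x
dominated-transfer R _ {[]} {[]} _ _ r = r
dominated-transfer {suc n} R transfer {x ∷ xs} {y ∷ ys} desc D@(p , _) r
  with d , refl ← m≤n⇒∃[o]m+o≡n {x} {y} (subst₂ _≤_ (+-identityʳ x) (+-identityʳ y) (p 1)) =
  settle d ys (Dominated-∷⁻ D) (subst (λ z → R (z ∷ ys)) (+-comm x d) r)
  where
  settle : ∀ d ys → Dominated d xs ys → R (d + x ∷ ys) → R (x ∷ xs)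
  settle zero ys D r =
    dominated-transfer (R ∘ (x ∷_)) (λ y i j → transfer (x ∷ y) (suc i) (suc j)) (Linked.tail desc) D r
  settle (suc d) ys D r with j , lt , D′ ← Dominated-raise d xs ys D =
    settle d (updateAt ys j suc) D′ (transfer (suc d + x ∷ ys) zero (suc j) ys[j]<d+x r)
    where
    -- The receiver is below its target in `xs`, which is at most `x` because the target sequence
    -- descends.
    ys[j]<d+x : lookup ys j < suc d + x
    ys[j]<d+x = <-≤-trans lt (≤-trans
      (Linked.lookup⁺ (flip ≤-trans) desc (z<s {toℕ j})) (m≤n+m x (suc d)))

-- Realisable sequences

increment : Subset n → Vec ℕ n → Vec ℕ n
increment = zipWith λ s x → if s then suc x else x

degreeSequence-∷ : ∀ e (E : Hypergraph m n) →
                   degreeSequence (e ∷ E) ≡ increment e (degreeSequence E)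
degreeSequence-∷ e E = go e (degree E)
  where
  go : ∀ {n} (e : Subset n) (f : Fin n → ℕ) →
       tabulate (λ v → (if does (v ∈? e) then suc else id) (f v)) ≡ increment e (tabulate f)
  go []            f = refl
  go (inside  ∷ e) f = cong (suc (f zero) ∷_) (go e (f ∘ suc))
  go (outside ∷ e) f = cong (f zero ∷_) (go e (f ∘ suc))

total-increment : ∀ (e : Subset n) x → total (increment e x) ≡ ∣ e ∣ + total x
total-increment []            []       = refl
total-increment (inside  ∷ e) (x ∷ xs) =
  cong suc (trans (cong (x +_) (total-increment e xs)) (x∙yz≈y∙xz x ∣ e ∣ (total xs)))
total-increment (outside ∷ e) (x ∷ xs) =
  trans (cong (x +_) (total-increment e xs)) (x∙yz≈y∙xz x ∣ e ∣ (total xs))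

total-degreeSequence : ∀ (E : Hypergraph m n) → total (degreeSequence E) ≡ total (dimensionSequence E)
total-degreeSequence {n = zero}  []      = refl
total-degreeSequence {n = suc n} []      = total-degreeSequence {n = n} []
total-degreeSequence             (e ∷ E) = begin
  total (degreeSequence (e ∷ E))            ≡⟨ cong total (degreeSequence-∷ e E) ⟩
  total (increment e (degreeSequence E))    ≡⟨ total-increment e _ ⟩
  ∣ e ∣ + total (degreeSequence E)          ≡⟨ cong (∣ e ∣ +_) (total-degreeSequence E) ⟩
  ∣ e ∣ + total (dimensionSequence E)       ∎
  where open ≡-Reasoning

Realisable⇒totals : ∀ {a : Vec ℕ n} {b : Vec ℕ m} → Realisable a b → total a ≡ total b
Realisable⇒totals (E , refl , refl) = total-degreeSequence E

Realisable⇒bounded : ∀ {a : Vec ℕ n} {b : Vec ℕ m} → Realisable a b → All (_≤ n) b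
Realisable⇒bounded (E , _ , refl) = go E
  where
  go : ∀ {m n} (E : Hypergraph m n) → All (_≤ n) (dimensionSequence E)
  go []      = []
  go (e ∷ E) = ∣p∣≤n e ∷ go E

-- With `g` and `h` arbitrary, removing a vertex (`h` is `pred`) and adding one (`h` is `suc`) are
-- two instances.
increment-updateAtˡ : ∀ {g h} (e : Subset n) x i →
                      (if g (lookup e i) then suc (lookup x i) else lookup x i) ≡
                      h (if lookup e i then suc (lookup x i) else lookup x i) →
                      increment (updateAt e i g) x ≡ updateAt (increment e x) i h
increment-updateAtˡ (_ ∷ _) (_ ∷ _) zero    eq = cong (_∷ _) eq
increment-updateAtˡ (_ ∷ e) (_ ∷ x) (suc i) eq = cong (_ ∷_) (increment-updateAtˡ e x i eq)

increment-updateAtʳ : ∀ {g h} (e : Subset n) x i →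
                      (if lookup e i then suc (g (lookup x i)) else g (lookup x i)) ≡
                      h (if lookup e i then suc (lookup x i) else lookup x i) →
                      increment e (updateAt x i g) ≡ updateAt (increment e x) i h
increment-updateAtʳ (_ ∷ _) (_ ∷ _) zero    eq = cong (_∷ _) eq
increment-updateAtʳ (_ ∷ e) (_ ∷ x) (suc i) eq = cong (_ ∷_) (increment-updateAtʳ e x i eq)

increment-transfer : ∀ (e : Subset n) x i j → 0 < lookup x i →
                     increment e (updateAt (updateAt x i pred) j suc) ≡
                     updateAt (updateAt (increment e x) i pred) j suc
increment-transfer e x i j 0<xᵢ = trans
  (increment-updateAtʳ e (updateAt x i pred) j (suc-commutes (lookup e j)))
  (cong (λ y → updateAt y j suc) (increment-updateAtʳ e x i (pred-commutes (lookup e i) 0<xᵢ)))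
  where
  suc-commutes : ∀ s {k : ℕ} → (if s then suc (suc k) else suc k) ≡ suc (if s then suc k else k)
  suc-commutes true  = refl
  suc-commutes false = refl

  pred-commutes : ∀ s {k} → 0 < k → (if s then suc (pred k) else pred k) ≡ pred (if s then suc k else k)
  pred-commutes true  (s≤s _) = refl
  pred-commutes false (s≤s _) = refl

∣p[i]≔outside∣ : ∀ (p : Subset n) i → lookup p i ≡ inside → suc ∣ p [ i ]≔ outside ∣ ≡ ∣ p ∣
∣p[i]≔outside∣ (inside  ∷ p) zero    eq = refl
∣p[i]≔outside∣ (inside  ∷ p) (suc i) eq = cong suc (∣p[i]≔outside∣ p i eq)
∣p[i]≔outside∣ (outside ∷ p) (suc i) eq = ∣p[i]≔outside∣ p i eq

∣p[i]≔inside∣ : ∀ (p : Subset n) i → lookup p i ≡ outside → ∣ p [ i ]≔ inside ∣ ≡ suc ∣ p ∣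
∣p[i]≔inside∣ (outside ∷ p) zero    eq = refl
∣p[i]≔inside∣ (inside  ∷ p) (suc i) eq = cong suc (∣p[i]≔inside∣ p i eq)
∣p[i]≔inside∣ (outside ∷ p) (suc i) eq = ∣p[i]≔inside∣ p i eq

-- Some edge contains i but not j; move it from i to j.
Realisable-transferable : ∀ {b : Vec ℕ m} → Transferable {n} (λ a → Realisable a b)
Realisable-transferable _ i j lt (E , refl , refl) = exchange E i j lt
  where
  exchange : ∀ {m n} (E : Hypergraph m n) i j →
             lookup (degreeSequence E) j < lookup (degreeSequence E) i →
             Realisable (updateAt (updateAt (degreeSequence E) i pred) j suc) (dimensionSequence E)
  exchange [] i j lt
    rewrite lookup∘tabulate (degree []) i | lookup∘tabulate (degree []) j = contradiction lt λ ()
  exchange (e ∷ E) i j lt = subst (λ y → Realisable (updateAt (updateAt y i pred) j suc) (dimensionSequence (e ∷ E)))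
    (sym (degreeSequence-∷ e E))
    (cases (lookup e i) (lookup e j) refl refl
      (subst₂ _<_ (lookup-zipWith _ j e _) (lookup-zipWith _ i e _)
        (subst (λ y → lookup y j < lookup y i) (degreeSequence-∷ e E) lt)))
    where
    d = degreeSequence E

    Goal : Set
    Goal = Realisable (updateAt (updateAt (increment e d) i pred) j suc) (dimensionSequence (e ∷ E))

    keep : lookup d j < lookup d i → Goal
    keep lt′ with E′ , degrees , dimensions ← exchange E i j lt′ =
      e ∷ E′ ,
      trans (degreeSequence-∷ e E′)
        (trans (cong (increment e) degrees) (increment-transfer e d i j (≤-<-trans z≤n lt′))) ,
      cong (∣ e ∣ ∷_) dimensions

    cases : ∀ s t → lookup e i ≡ s → lookup e j ≡ t →
            (if t then suc (lookup d j) else lookup d j) < (if s then suc (lookup d i) else lookup d i) →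
            Goal
    -- In the first three cases the strict inequality passes to the remaining edges, which supply
    -- the exchange. Without edges all degrees are 0, so the search ends at an edge of the fourth
    -- case.
    cases true  true  _  _  lt′ = keep (s<s⁻¹ lt′)
    cases false true  _  _  lt′ = keep (<⇒≤ lt′)
    cases false false _  _  lt′ = keep lt′
    cases true  false eᵢ eⱼ _   = e″ ∷ E , degrees , cong (_∷ _) dimension
      where
      e′ = e [ i ]≔ outside
      e″ = e′ [ j ]≔ inside

      i≢j : j ≢ i
      i≢j refl = contradiction (trans (sym eᵢ) eⱼ) λ ()

      e′ⱼ : lookup e′ j ≡ outside
      e′ⱼ = trans (lookup∘update′ i≢j e outside) eⱼ

      dimension : ∣ e″ ∣ ≡ ∣ e ∣
      dimension = trans (∣p[i]≔inside∣ e′ j e′ⱼ) (∣p[i]≔outside∣ e i eᵢ)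

      degrees : degreeSequence (e″ ∷ E) ≡ updateAt (updateAt (increment e d) i pred) j suc
      degrees = begin
        degreeSequence (e″ ∷ E)
          ≡⟨ degreeSequence-∷ e″ E ⟩
        increment e″ d
          ≡⟨ increment-updateAtˡ e′ d j (cong (λ s → suc (if s then _ else _)) (sym e′ⱼ)) ⟩
        updateAt (increment e′ d) j suc
          ≡⟨ cong (λ y → updateAt y j suc)
               (increment-updateAtˡ e d i (cong (λ s → pred (if s then _ else _)) (sym eᵢ))) ⟩
        updateAt (updateAt (increment e d) i pred) j suc
          ∎
        where open ≡-Reasoning

-- Initial segments and the conjugate sequence

initial : ℕ → Subset n
initial {zero}  _       = []
initial {suc n} zero    = outside ∷ initial zero
initial {suc n} (suc k) = inside ∷ initial k

∣initial∣ : ∀ {k} → k ≤ n → ∣ initial {n} k ∣ ≡ k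
∣initial∣ {zero}  z≤n       = refl
∣initial∣ {suc n} z≤n       = ∣initial∣ {n} z≤n
∣initial∣         (s≤s k≤n) = cong suc (∣initial∣ k≤n)

∈-initial : ∀ {k} {i : Fin n} → index i ≤ k → i ∈ initial k
∈-initial {i = zero}  (s≤s _)   = here
∈-initial {i = suc i} (s≤s i≤k) = there (∈-initial i≤k)

-- A component `k` is counted exactly at the indices up to `k`. Hence the conjugate accumulates like
-- the degrees of a hypergraph whose edges are initial segments.
conjugate-∷ : ∀ k (b : Vec ℕ m) → conjugate n (k ∷ b) ≡ increment (initial k) (conjugate n b)
conjugate-∷ k b = go k (λ i → count (index i ≤?_) b)
  where
  go : ∀ {n} k (f : Fin n → ℕ) →
       tabulate (λ i → (if does (index i ≤? k) then suc else id) (f i)) ≡ increment (initial k) (tabulate f)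
  go {zero}  k       f = refl
  go {suc n} zero    f = cong (f zero ∷_) (go zero (f ∘ suc))
  go {suc n} (suc k) f = cong (suc (f zero) ∷_) (go k (f ∘ suc))

-- Each of the first `k` components counts `k` itself, so the truncated subtraction is exact there.
reduceFirst-conjugate : ∀ k (b : Vec ℕ m) → reduceFirst k (conjugate n (k ∷ b)) ≡ conjugate n b
reduceFirst-conjugate {m} {n} k b = tabulate-cong go
  where
  y = conjugate n (k ∷ b)

  go : ∀ i → (if does (index i ≤? k) then lookup y i ∸ 1 else lookup y i) ≡ count (index i ≤?_) b
  go i rewrite lookup∘tabulate (λ i → count (index i ≤?_) (k ∷ b)) i with does (index i ≤? k)
  ... | true  = refl
  ... | false = refl

-- The raised positions form a prefix, so no entry is raised without its left neighbour.
Descending-increment : ∀ k {x : Vec ℕ n} → Descending x → Descending (increment (initial k) x)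
Descending-increment k             []                       = []
Descending-increment zero          [-]                      = [-]
Descending-increment (suc k)       [-]                      = [-]
Descending-increment zero          {_ ∷ _ ∷ _} (x≥y ∷ desc) = x≥y ∷ Descending-increment zero desc
Descending-increment (suc zero)    {_ ∷ _ ∷ _} (x≥y ∷ desc) = m≤n⇒m≤1+n x≥y ∷ Descending-increment zero desc
Descending-increment (suc (suc k)) {_ ∷ _ ∷ _} (x≥y ∷ desc) = s≤s x≥y ∷ Descending-increment (suc k) desc

Descending-conjugate : ∀ (b : Vec ℕ m) → Descending (conjugate n b)
Descending-conjugate {n = zero}        [] = []
Descending-conjugate {n = suc zero}    [] = [-]
Descending-conjugate {n = suc (suc n)} [] = z≤n ∷ Descending-conjugate {n = suc n} []
Descending-conjugate (k ∷ b) =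
  subst Descending (sym (conjugate-∷ k b)) (Descending-increment k (Descending-conjugate b))

Realisable-conjugate : ∀ {b : Vec ℕ m} → All (_≤ n) b → Realisable (conjugate n b) b
Realisable-conjugate []        = [] , refl , refl
Realisable-conjugate {b = k ∷ b} (k≤n ∷ b≤n) with E , degrees , dimensions ← Realisable-conjugate b≤n =
  initial k ∷ E ,
  trans (degreeSequence-∷ (initial k) E)
    (trans (cong (increment (initial k)) degrees) (sym (conjugate-∷ k b))) ,
  cong₂ _∷_ (∣initial∣ k≤n) dimensions

-- The sufficiency half of the Gale-Ryser theorem: transfers lead from the realisable conjugate down
-- to `x`.
gale–ryser : ∀ {x : Vec ℕ n} {b : Vec ℕ m} → Descending x → All (_≤ n) b →
             (∀ k → prefixSum k x ≤ prefixSum k (conjugate n b)) →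
             total x ≡ total (conjugate n b) →
             Realisable x b
gale–ryser desc b≤n dominated totals =
  dominated-transfer (λ a → Realisable a _) Realisable-transferable desc
    (dominated , totals) (Realisable-conjugate b≤n)

-- Excess over a threshold

excess : ℕ → List ℕ → ℕ
excess v xs = sum (List.map (_∸ v) xs)

prefixSum≤excess : ∀ k v (x : Vec ℕ n) → prefixSum k x ≤ k * v + excess v (toList x)
prefixSum≤excess zero    v x        = z≤n
prefixSum≤excess (suc k) v []       = z≤n
prefixSum≤excess (suc k) v (x ∷ xs) = begin
  x + prefixSum k xs                                ≤⟨ +-mono-≤ (m≤n+m∸n x v) (prefixSum≤excess k v xs) ⟩
  (v + (x ∸ v)) + (k * v + excess v (toList xs))    ≡⟨ interchange v (x ∸ v) (k * v) _ ⟩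
  (v + k * v) + ((x ∸ v) + excess v (toList xs))    ∎
  where open ≤-Reasoning

excess≡0 : ∀ {v} {x : Vec ℕ n} → All (_≤ v) x → excess v (toList x) ≡ 0
excess≡0 []           = refl
excess≡0 (x≤v ∷ xs≤v) = cong₂ _+_ (m≤n⇒m∸n≡0 x≤v) (excess≡0 xs≤v)

Descending⇒All≤head : ∀ {x} {xs : Vec ℕ n} → Descending (x ∷ xs) → All (_≤ x) (x ∷ xs)
Descending⇒All≤head = Linked.Linked⇒All (flip ≤-trans) ≤-refl

-- The threshold v is the last entry of the prefix, or 0 past the end.
prefixSum-attained : ∀ k {x} {xs : Vec ℕ n} → Descending (x ∷ xs) →
  ∃[ v ] v ≤ x × suc k * v + excess v (toList (x ∷ xs)) ≤ prefixSum (suc k) (x ∷ xs)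
prefixSum-attained zero {x} {xs} desc = x , ≤-refl , (begin
  x + 0 + excess x (x ∷ toList xs)    ≡⟨ cong (x + 0 +_) (excess≡0 (Descending⇒All≤head desc)) ⟩
  x + 0 + 0                           ≡⟨ +-identityʳ (x + 0) ⟩
  x + 0                               ∎)
  where open ≤-Reasoning
prefixSum-attained (suc k) {x} {[]} desc = 0 , z≤n , ≤-reflexive (cong (_+ (x + 0)) (*-zeroʳ k))
-- The bound `v ≤ x` is carried along so that `v + (x ∸ v)` is `x` at every earlier entry.
prefixSum-attained (suc k) {x} {xs@(_ ∷ _)} (x≥y ∷ desc)
  with v , v≤y , le ← prefixSum-attained k desc = v , v≤x , (begin
  (v + suc k * v) + ((x ∸ v) + excess v (toList xs))    ≡⟨ interchange v (suc k * v) (x ∸ v) _ ⟩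
  (v + (x ∸ v)) + (suc k * v + excess v (toList xs))    ≡⟨ cong (_+ _) (m+[n∸m]≡n v≤x) ⟩
  x + (suc k * v + excess v (toList xs))                ≤⟨ +-monoʳ-≤ x le ⟩
  x + prefixSum (suc k) xs                              ∎)
  where
  open ≤-Reasoning
  v≤x = ≤-trans v≤y x≥y

-- At the threshold where the bound by the excess is attained for `y`, the same bound for `x` can be
-- compared with it.
excess⇒prefixSum : ∀ {x y : Vec ℕ n} → Descending y →
                   (∀ v → excess v (toList x) ≤ excess v (toList y)) →
                   ∀ k → prefixSum k x ≤ prefixSum k y
excess⇒prefixSum                    _    _  zero    = z≤n
excess⇒prefixSum {x = []}  {[]}     _    _  (suc k) = z≤n
excess⇒prefixSum {x = x}   {_ ∷ _}  desc le (suc k) with v , _ , attained ← prefixSum-attained k desc =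
  ≤-trans (prefixSum≤excess (suc k) v x) (≤-trans (+-monoʳ-≤ (suc k * v) (le v)) attained)

excess-↭ : ∀ v {xs ys} → xs ↭ ys → excess v xs ≡ excess v ys
excess-↭ v p = sum-↭ (Perm.map⁺ (_∸ v) p)

excess-0 : ∀ xs → excess 0 xs ≡ sum xs
excess-0 xs = cong sum (List.map-id xs)

-- Reducing a sequence along an edge

-- Each selected vertex lowers the total by at most 1; it lowers it by 0 where truncated subtraction
-- meets a zero entry.
total≤∣e∣+total-reduceAt : ∀ (e : Subset n) x → total x ≤ ∣ e ∣ + total (reduceAt e x)
total≤∣e∣+total-reduceAt []            []       = z≤n
total≤∣e∣+total-reduceAt (inside  ∷ e) (x ∷ xs) = begin
  x + total xs                                     ≤⟨ +-mono-≤ (m≤n+m∸n x 1) (total≤∣e∣+total-reduceAt e xs) ⟩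
  (1 + (x ∸ 1)) + (∣ e ∣ + total (reduceAt e xs))  ≡⟨ cong suc (x∙yz≈y∙xz (x ∸ 1) ∣ e ∣ _) ⟩
  suc ∣ e ∣ + ((x ∸ 1) + total (reduceAt e xs))    ∎
  where open ≤-Reasoning
total≤∣e∣+total-reduceAt (outside ∷ e) (x ∷ xs) = begin
  x + total xs                             ≤⟨ +-monoʳ-≤ x (total≤∣e∣+total-reduceAt e xs) ⟩
  x + (∣ e ∣ + total (reduceAt e xs))      ≡⟨ x∙yz≈y∙xz x ∣ e ∣ _ ⟩
  ∣ e ∣ + (x + total (reduceAt e xs))      ∎
  where open ≤-Reasoning

All≤-reduceAt : ∀ {v} (e : Subset n) {x} → All (_≤ v) x → All (_≤ v) (reduceAt e x)
All≤-reduceAt []            []           = []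
All≤-reduceAt (inside  ∷ e) (x≤v ∷ xs≤v) = ≤-trans (m∸n≤m _ 1) x≤v ∷ All≤-reduceAt e xs≤v
All≤-reduceAt (outside ∷ e) (x≤v ∷ xs≤v) = x≤v ∷ All≤-reduceAt e xs≤v

∣e∩initial-0∣ : ∀ (e : Subset n) → ∣ e ∩ initial 0 ∣ ≡ 0
∣e∩initial-0∣ []            = refl
∣e∩initial-0∣ (inside  ∷ e) = ∣e∩initial-0∣ e
∣e∩initial-0∣ (outside ∷ e) = ∣e∩initial-0∣ e

-- t is the number of entries above v.  These stay at least v when reduced by
-- 1, and the other entries contribute nothing.
excess-reduceAt : ∀ v (e : Subset n) {x} → Descending x →
  ∃[ t ] t ≤ n × t * v + excess v (toList (reduceAt e x)) + ∣ e ∩ initial t ∣ ≤ prefixSum t x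
excess-reduceAt v [] {[]} _ = 0 , z≤n , z≤n
excess-reduceAt v e@(s ∷ e′) {x ∷ xs} desc with v <? x
-- The head is the largest entry, so no entry is above `v`, before or after the reduction.
... | no v≮x = 0 , z≤n , ≤-reflexive (cong₂ _+_
        (excess≡0 (All≤-reduceAt e (All.map (flip ≤-trans (≮⇒≥ v≮x)) (Descending⇒All≤head desc))))
        (∣e∩initial-0∣ e))
-- Here `w` is the excess of the head after a reduction by 1. If the head is selected, the missing
-- unit is supplied by its place in the intersection.
... | yes v<x with w , refl ← m≤n⇒∃[o]m+o≡n v<x
              with t , t≤n , le ← excess-reduceAt v e′ (Linked.tail desc) =
  suc t , s≤s t≤n , step s
  where
  open ≤-Reasoning
  open +-*-Solver
  E = excess v (toList (reduceAt e′ xs))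
  c = ∣ e′ ∩ initial t ∣

  step : ∀ s → suc t * v + excess v (toList (reduceAt (s ∷ e′) (x ∷ xs))) + ∣ (s ∷ e′) ∩ initial (suc t) ∣
               ≤ x + prefixSum t xs
  step inside = begin
    v + t * v + ((v + w ∸ v) + E) + suc c
      ≡⟨ cong (λ z → v + t * v + (z + E) + suc c) (m+n∸m≡n v w) ⟩
    v + t * v + (w + E) + suc c
      ≡⟨ solve 5 (λ v t w E c → v :+ t :+ (w :+ E) :+ (con 1 :+ c) := con 1 :+ v :+ w :+ (t :+ E :+ c))
           refl v (t * v) w E c ⟩
    x + (t * v + E + c)
      ≤⟨ +-monoʳ-≤ x le ⟩
    x + prefixSum t xs ∎
  step outside = begin
    v + t * v + ((x ∸ v) + E) + c
      ≡⟨ solve 5 (λ v t w E c → v :+ t :+ (w :+ E) :+ c := v :+ w :+ (t :+ E :+ c))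
           refl v (t * v) (x ∸ v) E c ⟩
    v + (x ∸ v) + (t * v + E + c)
      ≡⟨ cong (_+ (t * v + E + c)) (m+[n∸m]≡n (<⇒≤ v<x)) ⟩
    x + (t * v + E + c)
      ≤⟨ +-monoʳ-≤ x le ⟩
    x + prefixSum t xs ∎

-- At the `t` given by `excess-reduceAt`, the intersection with the edge occurs on both sides and
-- cancels, as does `t * v` once the prefix sum of `y` is bounded by its excess.
excess-reduceAt-≤ : ∀ (e : Subset n) {x} (y : Vec ℕ n) → Descending x →
  (∀ k → k ≤ n → prefixSum k x ≤ prefixSum k y + ∣ e ∩ initial k ∣) →
  ∀ v → excess v (toList (reduceAt e x)) ≤ excess v (toList y)
excess-reduceAt-≤ e {x} y desc le v with t , t≤n , le′ ← excess-reduceAt v e desc =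
  +-cancelˡ-≤ (t * v) _ _ (≤-trans
    (+-cancelʳ-≤ ∣ e ∩ initial t ∣ _ _ (≤-trans le′ (le t t≤n)))
    (prefixSum≤excess t v y))

-- The selected edge

Disjoint : Subset n → Subset n → Set
Disjoint p q = ∀ {i} → i ∈ p → i ∉ q

Disjoint-∷⁻ : ∀ {s t} {p q : Subset n} → Disjoint (s ∷ p) (t ∷ q) → Disjoint p q
Disjoint-∷⁻ disjoint i∈p i∈q = disjoint (there i∈p) (there i∈q)

∣p∪q∣ : ∀ (p q : Subset n) → Disjoint p q → ∣ p ∪ q ∣ ≡ ∣ p ∣ + ∣ q ∣
∣p∪q∣ []            []            _  = refl
∣p∪q∣ (inside  ∷ p) (inside  ∷ q) dj = contradiction here (dj here)
∣p∪q∣ (inside  ∷ p) (outside ∷ q) dj = cong suc (∣p∪q∣ p q (Disjoint-∷⁻ dj))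
∣p∪q∣ (outside ∷ p) (inside  ∷ q) dj = trans (cong suc (∣p∪q∣ p q (Disjoint-∷⁻ dj))) (sym (+-suc _ _))
∣p∪q∣ (outside ∷ p) (outside ∷ q) dj = ∣p∪q∣ p q (Disjoint-∷⁻ dj)

-- Disjointness ensures that no position is reduced twice.
reduceAt-∪ : ∀ (p q : Subset n) x → Disjoint p q → reduceAt q (reduceAt p x) ≡ reduceAt (p ∪ q) x
reduceAt-∪ []            []            []       _  = refl
reduceAt-∪ (inside  ∷ p) (inside  ∷ q) (x ∷ xs) dj = contradiction here (dj here)
reduceAt-∪ (inside  ∷ p) (outside ∷ q) (x ∷ xs) dj = cong (_ ∷_) (reduceAt-∪ p q xs (Disjoint-∷⁻ dj))
reduceAt-∪ (outside ∷ p) (inside  ∷ q) (x ∷ xs) dj = cong (_ ∷_) (reduceAt-∪ p q xs (Disjoint-∷⁻ dj))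
reduceAt-∪ (outside ∷ p) (outside ∷ q) (x ∷ xs) dj = cong (_ ∷_) (reduceAt-∪ p q xs (Disjoint-∷⁻ dj))

reduceAt-⊥ : ∀ (x : Vec ℕ n) → reduceAt ⊥ x ≡ x
reduceAt-⊥ []       = refl
reduceAt-⊥ (x ∷ xs) = cong (x ∷_) (reduceAt-⊥ xs)

-- Invariants of the selection

private
  variable
    μ : ℕ → ℕ
    d k k₀ : ℕ
    ks : List ℕ
    e e′ O : Subset n
    x x′ : Vec ℕ n

⊆⟨⟩-Disjoint : e ⊆⟨ 0 , k₀ ] → O ⊆⟨ k₀ , k ] → Disjoint e O
⊆⟨⟩-Disjoint e⊆ O⊆ i∈e i∈O = <⇒≱ (proj₁ (O⊆ i∈O)) (proj₂ (e⊆ i∈e))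

⊆⟨⟩-∪ : k₀ ≤ k → e ⊆⟨ 0 , k₀ ] → O ⊆⟨ k₀ , k ] → (e ∪ O) ⊆⟨ 0 , k ]
⊆⟨⟩-∪ {e = e} {O = O} k₀≤k e⊆ O⊆ i∈ with x∈p∪q⁻ e O i∈
... | inj₁ i∈e = z<s , ≤-trans (proj₂ (e⊆ i∈e)) k₀≤k
... | inj₂ i∈O = z<s , proj₂ (O⊆ i∈O)

Selecting⇒⊆ : Selecting μ d k₀ ks e x e′ x′ → e ⊆ e′
Selecting⇒⊆ done                  = id
Selecting⇒⊆ (select O _ _ _ rest) = Selecting⇒⊆ rest ∘ p⊆p∪q O

-- The partial edge stays within the indices already processed, hence disjoint from the next
-- selection, and the successive reductions merge into one.
Selecting⇒reduceAt : ∀ (a : Vec ℕ n) → AllPairs _≤_ (k₀ ∷ ks) → e ⊆⟨ 0 , k₀ ] → x ≡ reduceAt e a →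
                     Selecting μ d k₀ ks e x e′ x′ → x′ ≡ reduceAt e′ a
Selecting⇒reduceAt _ _ _ eq done = eq
Selecting⇒reduceAt {e = e} a ((k₀≤k ∷ _) ∷ ks↗) e⊆ refl (select O O⊆ _ _ rest) =
  Selecting⇒reduceAt a ks↗ (⊆⟨⟩-∪ k₀≤k e⊆ O⊆) (reduceAt-∪ e O a (⊆⟨⟩-Disjoint e⊆ O⊆)) rest

-- When `k` is processed, the lower end of the sampling range forces at least `μ k` vertices among
-- the first `k`; later selections only add vertices.
Selecting⇒margin : AllPairs _≤_ (k₀ ∷ ks) → e ⊆⟨ 0 , k₀ ] → Selecting μ d k₀ ks e x e′ x′ →
                   k ListMembership.∈ ks → μ k ≤ ∣ e′ ∩ initial k ∣
Selecting⇒margin ((k₀≤k ∷ _) ∷ ks↗) e⊆ (select O O⊆ _ _ rest) (Any.there k∈ks) =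
  Selecting⇒margin ks↗ (⊆⟨⟩-∪ k₀≤k e⊆ O⊆) rest k∈ks
Selecting⇒margin {e = e} {μ = μ} {e′ = e′} {k = k} ((k₀≤k ∷ _) ∷ _) e⊆
                 (select O O⊆ μ≤ _ rest) (Any.here refl) = begin
  μ k                         ≤⟨ m≤n+m∸n (μ k) ∣ e ∣ ⟩
  ∣ e ∣ + (μ k ∸ ∣ e ∣)       ≤⟨ +-monoʳ-≤ ∣ e ∣ μ≤ ⟩
  ∣ e ∣ + ∣ O ∣               ≡⟨ ∣p∪q∣ e O (⊆⟨⟩-Disjoint e⊆ O⊆) ⟨
  ∣ e ∪ O ∣                   ≤⟨ p⊆q⇒∣p∣≤∣q∣ (λ i∈ → x∈p∩q⁺
                                   (Selecting⇒⊆ rest i∈ , ∈-initial (proj₂ (⊆⟨⟩-∪ k₀≤k e⊆ O⊆ i∈)))) ⟩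
  ∣ e′ ∩ initial k ∣          ∎
  where open ≤-Reasoning

endpoints-ascending : ∀ (x y : Vec ℕ n) → AllPairs _≤_ (0 ∷ endpoints x y)
endpoints-ascending {n} x y = ListAll.universal (λ _ → z≤n) _ ∷ AllPairs.++⁺
  (AllPairs.filter⁺ critical? (AllPairs.applyUpTo⁺₁ suc (n ∸ 1) λ i<j _ → s≤s (<⇒≤ i<j)))
  ([] ∷ [])
  (ListAll.filter⁺ critical? (ListAll.applyUpTo⁺₁ suc (n ∸ 1) λ i<n∸1 → ≤-trans i<n∸1 (m∸n≤m n 1) ∷ []))
  where
  critical? = λ k → prefixSum k y <? prefixSum k x

∈-endpoints : ∀ (x y : Vec ℕ n) {k} → 0 < k → k ≤ n → prefixSum k y < prefixSum k x →
              k ListMembership.∈ endpoints x y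
∈-endpoints {n} x y {k = suc k} _ k<n violated with suc k ≟ n
-- Critical indices stay below `n`; a violation at `n` itself is covered by the appended last end
-- point.
... | yes refl = ∈-++⁺ʳ _ (Any.here refl)
... | no  k≢n  = ∈-++⁺ˡ (∈-filter⁺ (λ k → prefixSum k y <? prefixSum k x)
                   (∈-applyUpTo⁺ suc (≤-pred′ (≤∧≢⇒< k<n k≢n))) violated)
  where
  ≤-pred′ : ∀ {n} → suc k < n → k < n ∸ 1
  ≤-pred′ (s≤s lt) = lt

-- Where dominance is not violated, the bound holds without the edge; elsewhere the selected
-- vertices make up the margin.
Selecting⇒prefixSum≤ : ∀ {a : Vec ℕ n} y → Selecting (margin a y) d 0 (endpoints a y) ⊥ a e x →
                       ∀ k → k ≤ n → prefixSum k a ≤ prefixSum k y + ∣ e ∩ initial k ∣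
Selecting⇒prefixSum≤         y sel zero    _   = z≤n
Selecting⇒prefixSum≤ {a = a} y sel k@(suc _) k≤n with prefixSum k y <? prefixSum k a
... | no  ¬violated = ≤-trans (≮⇒≥ ¬violated) (m≤m+n _ _)
... | yes violated  = ≤-trans (m≤n+m∸n (prefixSum k a) (prefixSum k y)) (+-monoʳ-≤ (prefixSum k y)
  (Selecting⇒margin (endpoints-ascending a y) (λ i∈⊥ → contradiction i∈⊥ ∉⊥) sel
    (∈-endpoints a y z<s k≤n violated)))

-- Realising the reduced and sorted sequence

theorem3 : ∀ {m n : ℕ} (a : Vec ℕ n) (b : Vec ℕ (suc m)) (a′ : Vec ℕ n) (b′ : Vec ℕ m) →
    Descending a → Descending b →
    Realisable a b →
    Iteration a b a′ b′ →
    Realisable a′ b′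
theorem3 {n = n} a (b₁ ∷ b) a′ .b a↘ _ realisable
  record { edge = e ; reduced = x ; selecting = selecting ; size = size
         ; descending = a′↘ ; sorted = a′↭x ; rest = refl }
  = gale–ryser a′↘ (All.tail bounded)
      (excess⇒prefixSum (Descending-conjugate b) excess-a′) (≤-antisym total-≤ total-≥)
  where
  open ≤-Reasoning

  bounded : All (_≤ n) (b₁ ∷ b)
  bounded = Realisable⇒bounded realisable

  x≡ : x ≡ reduceAt e a
  x≡ = Selecting⇒reduceAt a (endpoints-ascending a _) (λ i∈⊥ → contradiction i∈⊥ ∉⊥)
         (sym (reduceAt-⊥ a)) selecting

  excess-x : ∀ v → excess v (toList x) ≤ excess v (toList (conjugate n b))
  excess-x rewrite x≡ = excess-reduceAt-≤ e (conjugate n b) a↘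
    (subst (λ y → ∀ k → k ≤ n → prefixSum k a ≤ prefixSum k y + ∣ e ∩ initial k ∣)
      (reduceFirst-conjugate b₁ b) (Selecting⇒prefixSum≤ _ selecting))

  excess-a′ : ∀ v → excess v (toList a′) ≤ excess v (toList (conjugate n b))
  excess-a′ v = ≤-trans (≤-reflexive (excess-↭ v a′↭x)) (excess-x v)

  -- At threshold 0 the excess is the total.
  total-≤ : total a′ ≤ total (conjugate n b)
  total-≤ = subst₂ _≤_ (excess-0 (toList a′)) (excess-0 (toList (conjugate n b))) (excess-a′ 0)

  -- Double counting of incidences for both pairs of sequences; the edge accounts for exactly `b₁`
  -- of them by `size`.
  total-≥ : total (conjugate n b) ≤ total a′
  total-≥ = +-cancelˡ-≤ b₁ _ _ (begin
    b₁ + total (conjugate n b)      ≡⟨ cong (b₁ +_) (Realisable⇒totals (Realisable-conjugate {n = n} (All.tail bounded))) ⟩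
    b₁ + total b                    ≡⟨ Realisable⇒totals realisable ⟨
    total a                         ≤⟨ total≤∣e∣+total-reduceAt e a ⟩
    ∣ e ∣ + total (reduceAt e a)    ≡⟨ cong₂ _+_ size (cong total (sym x≡)) ⟩
    b₁ + total x                    ≡⟨ cong (b₁ +_) (sum-↭ a′↭x) ⟨
    b₁ + total a′                   ∎)
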